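{- Assume $V=L$. Let $\xi\in\Xi$, $X\in\mathrm{IPS}_\xi$, let $F:D^\xi\to\mathcal N$ be continuous, and let $\mathcal U\subseteq\bigcup_{i\in T}\mathrm{IPS}_{[\subseteq i]}$ be a countable set. Then there is $Y\in\mathrm{IPS}_\xi$ with $Y\subseteq X$ such that the image $S=F[Y]$ is $U$-avoidable on $i$ for every $i\in T$ and every $U\in\mathrm{IPS}_{[\subseteq i]}\cap\mathcal U$.
   Context: $\mathcal N=\omega^\omega$, $D=2^\omega$. $T$ is the set of all nonempty finite sequences of countable ordinals, ordered by strict extension $\subset$; $[\subseteq i]=\{j\in T:j\subseteq i\}$, $[\subset i]=\{j\in T:j\subset i\}$. $\Xi$ is the set of all at most countable $\xi\subseteq T$ closed downward under $\subset$. $D^\xi$ is the product of $\xi$ copies of $D$ with the product topology ($D^\varnothing=\{\varnothing\}$); for $\eta\subseteq\xi$, $x\restriction\eta$ is restriction and $X\restriction\eta=\{x\restriction\eta:x\in X\}$. For $\zeta\in\Xi$, $\mathrm{IPS}_\zeta$ is the set of all $X\subseteq D^\zeta$ for which there is a homeomorphism $H$ of $D^\zeta$ onto $X$ such that for all $x_0,x_1\in D^\zeta$ and all $\eta\in\Xi$, $\eta\subseteq\zeta$: $x_0\restriction\eta=x_1\restriction\eta\iff H(x_0)\restriction\eta=H(x_1)\restriction\eta$. For $V\subseteq D^\zeta$ and $i\in\zeta$, $V{\Downarrow}i=\{v(i):v\in V\}$. For $i\in T$ and $U\in\mathrm{IPS}_{[\subseteq i]}$, a set $S\subseteq\mathcal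 N$ is $U$-avoidable on $i$ if there is a set $V\subseteq U$, clopen relative to $U$, with $V\restriction[\subset i]=U\restriction[\subset i]$ and $S\cap(V{\Downarrow}i)=\varnothing$. -}

module Defs where

open import Level using (Level; 0ℓ; _⊔_) renaming (suc to lsuc)
open import Data.Nat using (ℕ; suc)
open import Data.Fin using (Fin; zero; toℕ)
open import Data.List using (List; []; _∷_; length)
open import Data.List.NonEmpty using (List⁺; toList)
open import Data.List.Relation.Unary.All using (All)
import Data.List.Relation.Binary.Pointwise as Pointwise
open Pointwise using (Pointwise; []; _∷_)
open import Data.List.Relation.Binary.Prefix.Heterogeneous using (Prefix; []; _∷_)
import Data.List.Relation.Binary.Prefix.Heterogeneous.Properties as Prefix
open import Data.Product using (Σ; ∃; _×_; _,_; proj₁; proj₂)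
open import Data.Vec using (Vec; []; _∷_; lookup)
open import Function using (_∘_; _⇔_; Func; Injection; Inverse; _⟨$⟩_)
import Function.Relation.Binary.Setoid.Equality as FuncEq
open import Relation.Binary using (Setoid; _Respects_)
import Relation.Binary.Construct.On as On
open import Relation.Binary.PropositionalEquality as ≡ using (_≡_)
open import Relation.Nullary using (¬_)
open import Relation.Unary using (Pred; _∈_; _⊆_; _≐_; _∩_; ∁; Empty)

1ℓ : Level
1ℓ = lsuc 0ℓ

-- Aczel's iterative sets: sup A f is the set { f a : a ∈ A }. This is the
-- universe of sets to which V = L refers.
data 𝕍 : Set₁ where
  sup : (A : Set) → (A → 𝕍) → 𝕍

infix 4 _≈ᵛ_ _∈ᵛ_

_≈ᵛ_ : 𝕍 → 𝕍 → Set
sup A f ≈ᵛ sup B g = (∀ a → ∃ λ b → f a ≈ᵛ g b) × (∀ b → ∃ λ a → f a ≈ᵛ g b)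

≈ᵛ-refl : ∀ {x} → x ≈ᵛ x
≈ᵛ-refl {sup A f} = (λ a → a , ≈ᵛ-refl) , (λ a → a , ≈ᵛ-refl)

≈ᵛ-sym : ∀ {x y} → x ≈ᵛ y → y ≈ᵛ x
≈ᵛ-sym {sup A f} {sup B g} (l , r) =
  (λ b → proj₁ (r b) , ≈ᵛ-sym (proj₂ (r b))) ,
  (λ a → proj₁ (l a) , ≈ᵛ-sym (proj₂ (l a)))

≈ᵛ-trans : ∀ {x y z} → x ≈ᵛ y → y ≈ᵛ z → x ≈ᵛ z
≈ᵛ-trans {sup A f} {sup B g} {sup C h} (l , r) (l′ , r′) =
  (λ a → let b , p = l a ; c , q = l′ b in c , ≈ᵛ-trans p q) ,
  (λ c → let b , q = r′ c ; a , p = r b in a , ≈ᵛ-trans p q)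

𝕍-setoid : Setoid 1ℓ 0ℓ
𝕍-setoid = record
  { Carrier       = 𝕍
  ; _≈_           = _≈ᵛ_
  ; isEquivalence = record { refl = ≈ᵛ-refl ; sym = ≈ᵛ-sym ; trans = ≈ᵛ-trans }
  }

Index : 𝕍 → Set
Index (sup A f) = A

element : (x : 𝕍) → Index x → 𝕍
element (sup A f) = f

_∈ᵛ_ : 𝕍 → 𝕍 → Set
y ∈ᵛ x = ∃ λ a → y ≈ᵛ element x a

IsTransitive : Pred 𝕍 1ℓ
IsTransitive x = ∀ y z → y ∈ᵛ x → z ∈ᵛ y → z ∈ᵛ x

IsOrdinal : Pred 𝕍 1ℓ
IsOrdinal α = IsTransitive α × (∀ β → β ∈ᵛ α → IsTransitive β)

-- First-order formulas of the language {∈, =}, with n free variables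
-- in de Bruijn style.
data Formula : ℕ → Set where
  _ε_ _≗_ : ∀ {n} → Fin n → Fin n → Formula n
  neg     : ∀ {n} → Formula n → Formula n
  _and_   : ∀ {n} → Formula n → Formula n → Formula n
  ex      : ∀ {n} → Formula (suc n) → Formula n

-- Sat x φ ρ : the structure (x, ∈) satisfies φ at the assignment ρ.
Sat : ∀ (x : 𝕍) {n} → Formula n → Vec (Index x) n → Set
Sat x (i ε j)   ρ = element x (lookup ρ i) ∈ᵛ element x (lookup ρ j)
Sat x (i ≗ j)   ρ = element x (lookup ρ i) ≈ᵛ element x (lookup ρ j)
Sat x (neg φ)   ρ = ¬ Sat x φ ρ
Sat x (φ and ψ) ρ = Sat x φ ρ × Sat x ψ ρ
Sat x (ex φ)    ρ = ∃ λ a → Sat x φ (a ∷ ρ)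

-- Def x is the set of all { y ∈ x : (x, ∈) ⊨ φ(y, p₁, …, pₙ) }, where
-- p₁, …, pₙ ∈ x.
Def : 𝕍 → 𝕍
Def x = sup (∃ λ n → Formula (suc n) × Vec (Index x) n) λ (n , φ , ρ) →
          sup (∃ λ a → Sat x φ (a ∷ ρ)) (element x ∘ proj₁)

-- L α = ⋃ { Def (L β) : β ∈ α }; only its values at ordinals matter.
L : 𝕍 → 𝕍
L (sup A f) = sup (∃ λ a → Index (Def (L (f a)))) λ (a , d) → element (Def (L (f a))) d

V=L : Set₁
V=L = ∀ x → ∃ λ α → IsOrdinal α × x ∈ᵛ L α

-- Sets are represented by setoids; a subset inherits the ambient equality.
SubSetoid : ∀ {a ℓ p} (S : Setoid a ℓ) → Pred (Setoid.Carrier S) p → Setoid (a ⊔ p) ℓ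
SubSetoid S P = On.setoid S (proj₁ {B = P})

-- At most countable: finite and empty setoids are included.
Countable : ∀ {a ℓ} → Setoid a ℓ → Set (a ⊔ ℓ)
Countable S = Injection S (≡.setoid ℕ)

IsCountableOrdinal : Pred 𝕍 1ℓ
IsCountableOrdinal α = IsOrdinal α × Countable (SubSetoid 𝕍-setoid (_∈ᵛ α))

ω₁ : Setoid 1ℓ 0ℓ
ω₁ = SubSetoid 𝕍-setoid IsCountableOrdinal

T-setoid : Setoid 1ℓ 1ℓ
T-setoid = On.setoid (Pointwise.setoid ω₁) (toList {A = Setoid.Carrier ω₁})

open Setoid T-setoid public using () renaming (Carrier to T; _≈_ to _≈ᵀ_)

infix 4 _⊑_ _⊏_

_⊑_ _⊏_ : T → T → Set₁
j ⊑ i = Prefix (Setoid._≈_ ω₁) (toList j) (toList i)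
j ⊏ i = j ⊑ i × ¬ (j ≈ᵀ i)

record IsΞ (ξ : Pred T 1ℓ) : Set₁ where
  field
    resp      : ξ Respects _≈ᵀ_
    closed    : ∀ {i j} → i ∈ ξ → j ⊏ i → j ∈ ξ
    countable : Countable (SubSetoid T-setoid ξ)

Ξ : Set₂
Ξ = Σ (Pred T 1ℓ) IsΞ

⟦_⟧ : Ξ → Pred T 1ℓ
⟦_⟧ = proj₁

⊑-trans : ∀ {i j k} → i ⊑ j → j ⊑ k → i ⊑ k
⊑-trans = Prefix.trans λ {α} {β} {γ} → Setoid.trans ω₁ {α} {β} {γ}

≈⇒⊑ : ∀ {i j} → i ≈ᵀ j → i ⊑ j
≈⇒⊑ = Prefix.fromPointwise

[⊑_] : T → Ξ
[⊑ i ] = (_⊑ i) , record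
  { resp      = λ {j} {k} j≈k j⊑i → ⊑-trans {k} {j} {i} (≈⇒⊑ {k} {j} (Setoid.sym T-setoid {j} {k} j≈k)) j⊑i
  ; closed    = λ {j} {k} j⊑i k⊏j → ⊑-trans {k} {j} {i} (proj₁ k⊏j) j⊑i
  ; countable = record
    { to        = λ (j , _) → length (toList j)
    ; cong      = Pointwise.Pointwise-length
    ; injective = λ {(_ , p)} {(_ , q)} → equal p q
    }
  }
  where
  open Setoid ω₁ using (_≈_; sym; trans)
  equal : ∀ {as bs cs} → Prefix _≈_ as cs → Prefix _≈_ bs cs →
          length as ≡ length bs → Pointwise _≈_ as bs
  equal []       []       _    = []
  equal []       (_ ∷ _)  ()
  equal (_ ∷ _)  []       ()
  equal (_∷_ {a = a} {b = c} p ps) (_∷_ {a = b} q qs) eq =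
    trans {a} {c} {b} p (sym {b} {c} q) ∷ equal ps qs (≡.cong Data.Nat.pred eq)
    where import Data.Nat

[⊏_] : T → Pred T 1ℓ
[⊏ i ] = _⊏ i

-- A topology is presented by a subbase.
record Space c ℓ s : Set (lsuc (c ⊔ ℓ ⊔ s)) where
  field
    setoid : Setoid c ℓ
  open Setoid setoid public
  field
    Subbase : Set s
    _◂_     : Carrier → Subbase → Set
    ◂-resp  : ∀ b → (_◂ b) Respects _≈_

  -- Every point of O lies in a finite intersection of subbasic sets that
  -- is included in O.
  Open : Pred Carrier 1ℓ → Set (c ⊔ s ⊔ 1ℓ)
  Open O = ∀ {x} → x ∈ O →
    ∃ λ bs → All (x ◂_) bs × (∀ {y} → All (y ◂_) bs → y ∈ O)

  Clopen : Pred Carrier 1ℓ → Set (c ⊔ s ⊔ 1ℓ)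
  Clopen O = Open O × Open (∁ O)

∣_∣ : ∀ {c ℓ s} → Space c ℓ s → Set c
∣ A ∣ = Space.Carrier A

discrete : Set → Space 0ℓ 0ℓ 0ℓ
discrete A = record
  { setoid  = ≡.setoid A
  ; Subbase = A
  ; _◂_     = _≡_
  ; ◂-resp  = λ { _ ≡.refl p → p }
  }

-- The product topology on A^I; I is a setoid, so points are setoid maps.
Power : ∀ {i ℓ₁ a ℓ₂ s} → Space a ℓ₂ s → Setoid i ℓ₁ →
        Space (i ⊔ ℓ₁ ⊔ a ⊔ ℓ₂) (i ⊔ ℓ₂) (i ⊔ s)
Power A I = record
  { setoid  = FuncEq.setoid I (Space.setoid A)
  ; Subbase = Setoid.Carrier I × Space.Subbase A
  ; _◂_     = λ x (k , b) → Space._◂_ A (x ⟨$⟩ k) b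
  ; ◂-resp  = λ (k , b) x≈y → Space.◂-resp A b (x≈y k)
  }

Subspace : ∀ {ℓ s} (A : Space 1ℓ ℓ s) → Pred ∣ A ∣ 1ℓ → Space 1ℓ ℓ s
Subspace A X = record
  { setoid  = SubSetoid (Space.setoid A) X
  ; Subbase = Space.Subbase A
  ; _◂_     = λ (x , _) b → Space._◂_ A x b
  ; ◂-resp  = λ b {x} {y} → Space.◂-resp A b {proj₁ x} {proj₁ y}
  }

-- A continuous f respects the equalities, since subbasic sets do.
Continuous : ∀ {a ℓ₁ s₁ b ℓ₂ s₂} (A : Space a ℓ₁ s₁) (B : Space b ℓ₂ s₂) →
             (∣ A ∣ → ∣ B ∣) → Set (a ⊔ s₁ ⊔ b ⊔ s₂ ⊔ lsuc 1ℓ)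
Continuous A B f = ∀ O → Space.Open B O → Space.Open A (O ∘ f)

record Homeomorphism {a ℓ₁ s₁ b ℓ₂ s₂} (A : Space a ℓ₁ s₁) (B : Space b ℓ₂ s₂) :
                     Set (a ⊔ ℓ₁ ⊔ s₁ ⊔ b ⊔ ℓ₂ ⊔ s₂ ⊔ lsuc 1ℓ) where
  field
    inverse         : Inverse (Space.setoid A) (Space.setoid B)
  open Inverse inverse public
  field
    to-continuous   : Continuous A B to
    from-continuous : Continuous B A from

𝒩 : Space 0ℓ 0ℓ 0ℓ
𝒩 = Power (discrete ℕ) (≡.setoid ℕ)

D : Space 0ℓ 0ℓ 0ℓ
D = Power (discrete (Fin 2)) (≡.setoid ℕ)

D⊆𝒩 : ∣ D ∣ → ∣ 𝒩 ∣
D⊆𝒩 d = record { to = λ n → toℕ (d ⟨$⟩ n) ; cong = ≡.cong (λ n → toℕ (d ⟨$⟩ n)) }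

infix 10 D^_

D^_ : Pred T 1ℓ → Space 1ℓ 1ℓ 1ℓ
D^ ξ = Power D (SubSetoid T-setoid ξ)

infixl 8 _↾_ _↾ˢ_

_↾_ : ∀ {ξ η} → ∣ D^ ξ ∣ → η ⊆ ξ → ∣ D^ η ∣
x ↾ η⊆ξ = record
  { to   = λ (i , i∈η) → x ⟨$⟩ (i , η⊆ξ i∈η)
  ; cong = Func.cong x
  }

_↾ˢ_ : ∀ {ξ η} → Pred ∣ D^ ξ ∣ 1ℓ → η ⊆ ξ → Pred ∣ D^ η ∣ 1ℓ
_↾ˢ_ {ξ} {η} X η⊆ξ y = ∃ λ x → x ∈ X × (x ↾ η⊆ξ) ≈ y
  where open Space (D^ η)

ProjectionKeeping : ∀ (ζ : Ξ) {X : Pred ∣ D^ ⟦ ζ ⟧ ∣ 1ℓ} →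
                    (∣ D^ ⟦ ζ ⟧ ∣ → ∣ Subspace (D^ ⟦ ζ ⟧) X ∣) → Set₂
ProjectionKeeping ζ H =
  ∀ x₀ x₁ (η : Ξ) (η⊆ζ : ⟦ η ⟧ ⊆ ⟦ ζ ⟧) → let open Space (D^ ⟦ η ⟧) in
    (x₀ ↾ η⊆ζ) ≈ (x₁ ↾ η⊆ζ) ⇔ (proj₁ (H x₀) ↾ η⊆ζ) ≈ (proj₁ (H x₁) ↾ η⊆ζ)

IPS : (ζ : Ξ) → Pred (Pred ∣ D^ ⟦ ζ ⟧ ∣ 1ℓ) (lsuc 1ℓ)
IPS ζ X = X Respects Space._≈_ (D^ ⟦ ζ ⟧) ×
  Σ (Homeomorphism (D^ ⟦ ζ ⟧) (Subspace (D^ ⟦ ζ ⟧) X)) λ H →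
    ProjectionKeeping ζ {X} (Homeomorphism.to H)

-- Pairs (i , U) with U ⊆ D^[⊑i]; these are equal when the second components
-- are equal as sets of functions, each element carrying its own domain.
Coded : Set₂
Coded = Σ T λ i → Pred ∣ D^ ⟦ [⊑ i ] ⟧ ∣ 1ℓ

infix 4 _≋_

_≋_ : ∀ {ξ η} → ∣ D^ ξ ∣ → ∣ D^ η ∣ → Set₁
_≋_ {ξ} {η} x y = ξ ≐ η ×
  (∀ i (p : i ∈ ξ) (q : i ∈ η) → Space._≈_ D (x ⟨$⟩ (i , p)) (y ⟨$⟩ (i , q)))

≋-refl : ∀ {ξ} {x : ∣ D^ ξ ∣} → x ≋ x
≋-refl {x = x} =
  ((λ p → p) , λ p → p) , λ i p q → Func.cong x {i , p} {i , q} (Setoid.refl T-setoid {i})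

≋-sym : ∀ {ξ η} {x : ∣ D^ ξ ∣} {y : ∣ D^ η ∣} → x ≋ y → y ≋ x
≋-sym ((l , r) , e) = (r , l) , λ i p q n → ≡.sym (e i q p n)

≋-trans : ∀ {ξ η ζ} {x : ∣ D^ ξ ∣} {y : ∣ D^ η ∣} {z : ∣ D^ ζ ∣} → x ≋ y → y ≋ z → x ≋ z
≋-trans ((l , r) , e) ((l′ , r′) , e′) =
  ((λ p → l′ (l p)) , λ q → r (r′ q)) ,
  λ i p q n → ≡.trans (e i p (l p) n) (e′ i (l p) q n)

Coded-setoid : Setoid (lsuc 1ℓ) 1ℓ
Coded-setoid = record
  { Carrier = Coded
  ; _≈_     = λ (_ , U) (_ , W) →
      (∀ x → x ∈ U → ∃ λ y → y ∈ W × x ≋ y) × (∀ y → y ∈ W → ∃ λ x → x ∈ U × x ≋ y)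
  ; isEquivalence = record
    { refl  = (λ x x∈U → x , x∈U , ≋-refl {x = x}) , (λ x x∈U → x , x∈U , ≋-refl {x = x})
    ; sym   = λ (l , r) →
        (λ y m → let x , m′ , e = r y m in x , m′ , ≋-sym {x = x} {y} e) ,
        (λ x m → let y , m′ , e = l x m in y , m′ , ≋-sym {x = x} {y} e)
    ; trans = λ (l , r) (l′ , r′) →
        (λ x m → let y , m′ , e = l x m ; z , m″ , e′ = l′ y m′ in
                 z , m″ , ≋-trans {x = x} {y} {z} e e′) ,
        (λ z m → let y , m′ , e′ = r′ z m ; x , m″ , e = r y m′ in
                 x , m″ , ≋-trans {x = x} {y} {z} e e′)
    }
  }

infix 9 _⇓_ _[_]

-- { v(i) : v ∈ V } is taken as a subset of 𝒩 ⊇ D, to be compared with S ⊆ 𝒩.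
_⇓_ : ∀ {ζ} → Pred ∣ D^ ζ ∣ 1ℓ → Σ T ζ → Pred ∣ 𝒩 ∣ 1ℓ
(V ⇓ i) n = ∃ λ v → v ∈ V × D⊆𝒩 (v ⟨$⟩ i) ≈ n
  where open Space 𝒩

_[_] : ∀ {ξ} → (∣ D^ ξ ∣ → ∣ 𝒩 ∣) → Pred ∣ D^ ξ ∣ 1ℓ → Pred ∣ 𝒩 ∣ 1ℓ
(F [ Y ]) n = ∃ λ y → y ∈ Y × F y ≈ n
  where open Space 𝒩

⊑-refl : ∀ i → i ⊑ i
⊑-refl i = ≈⇒⊑ {i} {i} (Setoid.refl T-setoid {i})

Avoidable : ∀ i → Pred ∣ D^ ⟦ [⊑ i ] ⟧ ∣ 1ℓ → Pred ∣ 𝒩 ∣ 1ℓ → Set₂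
Avoidable i U S = Σ (Pred ∣ D^ ⟦ [⊑ i ] ⟧ ∣ 1ℓ) λ V →
  V ⊆ U ×
  Space.Clopen (Subspace (D^ ⟦ [⊑ i ] ⟧) U) (V ∘ proj₁) ×
  (V ↾ˢ ⊏⊆⊑) ≐ (U ↾ˢ ⊏⊆⊑) ×
  Empty (S ∩ (V ⇓ (i , ⊑-refl i)))
  where
  ⊏⊆⊑ : [⊏ i ] ⊆ ⟦ [⊑ i ] ⟧
  ⊏⊆⊑ = proj₁

{-# OPTIONS --safe #-}

-- A finite set P of points has a neighbourhood that is U-avoidable on i: cut U into more than |P|
-- pieces by the first digits of the i-th coordinate of the parameter. By uniform continuity of the
-- homeomorphism and of its inverse, for each fixed value of the coordinates below i a small ball
-- around a point of P meets at most one piece, so some piece misses all the balls, and this can be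
-- decided from finitely many digits. Hence it is enough that for the n-th member of 𝒰 the image F[Y]
-- is covered by sufficiently many, sufficiently small balls. The number of balls is fixed in advance:
-- Y is the image under the homeomorphism of X of a product of perfect sets, in which the n-th digit is
-- free only at a place so late that the first n free digits determine F up to the n-th precision.
module Submission where

open import Defs
open import Axiom.ExcludedMiddle using (ExcludedMiddle)
open import Data.Product using (Σ; _×_; _,_)
open import Function using (_⟨$⟩_; Func)
open import Relation.Unary using (Pred; _∈_; _⊆_)

open import Data.Fin using (Fin; zero; suc; toℕ; splitAt; _↑ˡ_; _↑ʳ_)
import Data.Fin.Properties as Fin
open import Data.List using ([]; _∷_; _++_; map)
import Data.List.Relation.Binary.Prefix.Heterogeneous.Properties as Prefix
open import Data.List.Relation.Unary.All as All using (All; []; _∷_)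
import Data.List.Relation.Unary.All.Properties as All
open import Data.Nat as ℕ using (ℕ; zero; suc; _+_; _*_; _≤_; _<_)
import Data.Nat.Properties as ℕ
open import Data.Product using (∃; proj₁; proj₂)
open import Data.Sum using (_⊎_; inj₁; inj₂; [_,_]′)
open import Function using (_∘_; id; Equivalence; Injection; mk⇔)
open import Level using (0ℓ; _⊔_; Lift; lift; lower)
open import Relation.Binary using (Setoid; _Respects_; tri<; tri≈; tri>)
open import Relation.Binary.PropositionalEquality using (_≡_; _≢_; refl; sym; trans; cong; subst)
open import Relation.Nullary using (¬_; Dec; yes; no; contradiction)
open import Relation.Nullary.Decidable using (decidable-stable)
open import Relation.Unary using (_≐_; ∁; Empty; _∩_)

-- Pairing, bounded choice and sparse sequences of natural numbers.

-- This is 2^a (2b + 1), so injectivity follows by parity and induction on a.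
pair : ℕ → ℕ → ℕ
pair zero    b = suc (2 * b)
pair (suc a) b = 2 * pair a b

pair-injective : ∀ a c {b d} → pair a b ≡ pair c d → a ≡ c × b ≡ d
pair-injective zero    zero    {b} {d} eq = refl , ℕ.*-cancelˡ-≡ b d 2 (ℕ.suc-injective eq)
pair-injective zero    (suc c) {b} {d} eq = contradiction (sym eq) (ℕ.even≢odd (pair c d) b)
pair-injective (suc a) zero    {b} {d} eq = contradiction eq (ℕ.even≢odd (pair a b) d)
pair-injective (suc a) (suc c) {b} {d} eq =
  let a≡c , b≡d = pair-injective a c (ℕ.*-cancelˡ-≡ (pair a b) (pair c d) 2 eq) in cong suc a≡c , b≡d

n≤pair : ∀ a n → n ≤ pair a n
n≤pair zero    n = ℕ.m≤n⇒m≤1+n (ℕ.m≤n*m n 2)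
n≤pair (suc a) n = ℕ.≤-trans (n≤pair a n) (ℕ.m≤n*m _ 2)

-- The maximum of the finitely many witnesses works. This merges moduli found digit by digit into
-- one modulus.
bounded-choice : ∀ {p} (P : ℕ → ℕ → Set p) → (∀ k {m n} → m ≤ n → P k m → P k n) →
                 (∀ k → ∃ (P k)) → ∀ b → ∃ λ n → ∀ k → k < b → P k n
bounded-choice P mono choice zero    = 0 , λ _ ()
bounded-choice P mono choice (suc b) =
  let m , below = bounded-choice P mono choice b
      n , at    = choice b
  in m ℕ.⊔ n , λ k k<1+b →
       [ (λ k<b → mono k (ℕ.m≤m⊔n m n) (below k k<b))
       , (λ { refl → mono b (ℕ.m≤n⊔m m n) at }) ]′ (ℕ.m<1+n⇒m<n∨m≡n k<1+b)

-- Later `t n` is the place of the n-th free digit, and `f n` is the earliest place allowed for it.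
record StrictlyIncreasingAbove (f : ℕ → ℕ) : Set where
  field
    t        : ℕ → ℕ
    f≤t      : ∀ n → f n ≤ t n
    t-mono-< : ∀ {m n} → m < n → t m < t n

  t-cancel-< : ∀ {m n} → t m < t n → m < n
  t-cancel-< {m} {n} tm<tn with m ℕ.<? n
  ... | yes m<n = m<n
  ... | no  m≮n with ℕ.m≤n⇒m<n∨m≡n (ℕ.≮⇒≥ m≮n)
  ...   | inj₁ n<m  = contradiction tm<tn (ℕ.<-asym (t-mono-< n<m))
  ...   | inj₂ refl = contradiction tm<tn (ℕ.<-irrefl refl)

  t-injective : ∀ {m n} → t m ≡ t n → m ≡ n
  t-injective {m} {n} eq with ℕ.<-cmp m n
  ... | tri< m<n _ _ = contradiction eq (ℕ.<⇒≢ (t-mono-< m<n))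
  ... | tri≈ _ m≡n _ = m≡n
  ... | tri> _ _ n<m = contradiction (sym eq) (ℕ.<⇒≢ (t-mono-< n<m))

strictlyIncreasingAbove : ∀ f → StrictlyIncreasingAbove f
strictlyIncreasingAbove f = record
  { t = t ; f≤t = f≤t ; t-mono-< = λ m<n → mono (ℕ.≤⇒≤′ m<n) }
  where
  t : ℕ → ℕ
  t zero    = f zero
  t (suc n) = suc (t n) ℕ.⊔ f (suc n)
  t<t : ∀ n → t n < t (suc n)
  t<t n = ℕ.m≤m⊔n (suc (t n)) (f (suc n))
  f≤t : ∀ n → f n ≤ t n
  f≤t zero    = ℕ.≤-refl
  f≤t (suc n) = ℕ.m≤n⊔m (suc (t n)) (f (suc n))
  mono : ∀ {m n} → suc m ℕ.≤′ n → t m < t n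
  mono ℕ.≤′-refl       = t<t _
  mono (ℕ.≤′-step m<n) = ℕ.<-trans (mono m<n) (t<t _)

-- Continuity in terms of subbasic neighbourhoods.

module _ {c ℓ s} (A : Space c ℓ s) where
  open Space A

  -- The condition of `Open` at a single point, for a predicate of any level.
  Near : ∀ {p} → Carrier → Pred Carrier p → Set (c ⊔ s ⊔ p)
  Near x P = ∃ λ bs → All (x ◂_) bs × (∀ {y} → All (y ◂_) bs → P y)

  near-All : ∀ {b p} {B : Set b} {P : B → Pred Carrier p} {x bs} →
             All (λ b → Near x (P b)) bs → Near x (λ y → All (λ b → P b y) bs)
  near-All []                     = [] , [] , λ _ → []
  near-All ((cs , x◂cs , f) ∷ ns) =
    let ds , x◂ds , g = near-All ns in
    cs ++ ds , All.++⁺ x◂cs x◂ds , λ y◂ → f (All.++⁻ˡ cs y◂) ∷ g (All.++⁻ʳ cs y◂)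

  open-resp : ∀ {O} → Open O → O Respects _≈_
  open-resp O-open x≈y x∈O =
    let _ , x◂bs , f = O-open x∈O in f (All.map (λ {b} → ◂-resp b x≈y) x◂bs)

module _ {a ℓ₁ s₁ b ℓ₂ s₂} (A : Space a ℓ₁ s₁) (B : Space b ℓ₂ s₂) where
  private
    module A = Space A
    module B = Space B

  SubbasicallyContinuous : (∣ A ∣ → ∣ B ∣) → Set _
  SubbasicallyContinuous f = ∀ {x} b → f x B.◂ b → Near A x (λ y → f y B.◂ b)

  continuous⇒subbasically : ∀ {f} → Continuous A B f → SubbasicallyContinuous f
  continuous⇒subbasically {f} f-cont b fx◂b =
    -- `Lift` brings the subbasic set to the level at which `Open` is stated.
    let bs , x◂bs , g = f-cont (λ y → Lift 1ℓ (y B.◂ b))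
          (λ { (lift y◂b) → b ∷ [] , y◂b ∷ [] , λ { (z◂b ∷ []) → lift z◂b } }) (lift fx◂b)
    in bs , x◂bs , lower ∘ g

  near-preimage : ∀ {f p} → SubbasicallyContinuous f → ∀ {P : Pred ∣ B ∣ p} {x} →
                  Near B (f x) P → Near A x (P ∘ f)
  near-preimage f-sub (bs , fx◂bs , g) =
    let cs , x◂cs , h = near-All A (All.map (λ {b} → f-sub b) fx◂bs) in cs , x◂cs , g ∘ h

  subbasically⇒continuous : ∀ {f} → SubbasicallyContinuous f → Continuous A B f
  subbasically⇒continuous f-sub O O-open fx∈O =
    near-preimage f-sub (O-open fx∈O)

continuous-∘ : ∀ {a ℓ₁ s₁ b ℓ₂ s₂ c ℓ₃ s₃} (A : Space a ℓ₁ s₁) (B : Space b ℓ₂ s₂) (C : Space c ℓ₃ s₃)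
               {f : ∣ A ∣ → ∣ B ∣} {g : ∣ B ∣ → ∣ C ∣} →
               Continuous B C g → Continuous A B f → Continuous A C (g ∘ f)
continuous-∘ A B C {g = g} g-cont f-cont O O-open = f-cont (O ∘ g) (g-cont O O-open)

continuous-proj₁ : ∀ {a ℓ₁ s₁ ℓ s} (A : Space a ℓ₁ s₁) (B : Space 1ℓ ℓ s) {P : Pred ∣ B ∣ 1ℓ} {f : ∣ A ∣ → Σ ∣ B ∣ P} →
                   Continuous A (Subspace B P) f → Continuous A B (proj₁ ∘ f)
continuous-proj₁ A B {P} {f} f-cont =
  subbasically⇒continuous A B (λ {x} → continuous⇒subbasically A (Subspace B P) {f} f-cont {x})

continuous⇒locallyConstant : ∀ {c ℓ s} (A : Space c ℓ s) {F : ∣ A ∣ → ∣ 𝒩 ∣} → Continuous A 𝒩 F →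
                             ∀ k x → Near A x (λ y → F y ⟨$⟩ k ≡ F x ⟨$⟩ k)
continuous⇒locallyConstant A F-cont k x =
  continuous⇒subbasically A 𝒩 F-cont {x} (k , _) refl

-- Equal points lie in the same subbasic sets, hence in the same neighbourhood on which a digit of F
-- is constant.
continuous⇒cong : ∀ {c ℓ s} (A : Space c ℓ s) {F : ∣ A ∣ → ∣ 𝒩 ∣} → Continuous A 𝒩 F →
                  ∀ {x y} → Space._≈_ A x y → ∀ k → F y ⟨$⟩ k ≡ F x ⟨$⟩ k
continuous⇒cong A F-cont {x} x≈y k =
  let _ , x◂bs , f = continuous⇒locallyConstant A F-cont k x in
  f (All.map (λ {b} → Space.◂-resp A b x≈y) x◂bs)

-- Initial segments of T and digits of points.

≈ᵀ-sym : ∀ {i j} → i ≈ᵀ j → j ≈ᵀ i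
≈ᵀ-sym {i} {j} = Setoid.sym T-setoid {i} {j}

≈ᵀ-trans : ∀ {i j k} → i ≈ᵀ j → j ≈ᵀ k → i ≈ᵀ k
≈ᵀ-trans {i} {j} {k} = Setoid.trans T-setoid {i} {j} {k}

⊑-antisym : ∀ {i j} → i ⊑ j → j ⊑ i → i ≈ᵀ j
⊑-antisym = Prefix.antisym λ p _ → p

-- `ProjectionKeeping` quantifies over members of `Ξ`; this form lets it be applied to the
-- coordinates strictly below i.
[⊏_]ᶻ : T → Ξ
[⊏ i ]ᶻ = [⊏ i ] , record
  { resp      = λ {j} {k} j≈k (j⊑i , j≉i) →
      IsΞ.resp (proj₂ [⊑ i ]) {j} {k} j≈k j⊑i , λ k≈i → j≉i (≈ᵀ-trans {j} {k} {i} j≈k k≈i)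
  ; closed    = λ {j} {k} (j⊑i , j≉i) (k⊑j , k≉j) →
      ⊑-trans {k} {j} {i} k⊑j j⊑i ,
      λ k≈i → j≉i (⊑-antisym {j} {i} j⊑i
        (⊑-trans {i} {k} {j} (≈⇒⊑ {i} {k} (≈ᵀ-sym {k} {i} k≈i)) k⊑j))
  ; countable = record
    { to        = λ (j , j⊏i) → to (j , proj₁ j⊏i)
    ; cong      = λ {x} {y} → Injection.cong count {proj₁ x , proj₁ (proj₂ x)} {proj₁ y , proj₁ (proj₂ y)}
    ; injective = λ {x} {y} → injective {proj₁ x , proj₁ (proj₂ x)} {proj₁ y , proj₁ (proj₂ y)}
    }
  }
  where
  count = IsΞ.countable (proj₂ [⊑ i ])
  open Injection count

bit : ∀ {ξ} → ∣ D^ ξ ∣ → Σ T ξ → ℕ → Fin 2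
bit x j k = (x ⟨$⟩ j) ⟨$⟩ k

origin : ∀ {ξ} → ∣ D^ ξ ∣
origin = record { to = λ _ → record { to = λ _ → zero ; cong = λ _ → refl } ; cong = λ _ _ → refl }

Fin2-≢-≢⇒≡ : ∀ {a b c : Fin 2} → a ≢ c → b ≢ c → a ≡ b
Fin2-≢-≢⇒≡ {zero}     {zero}     _   _   = refl
Fin2-≢-≢⇒≡ {suc zero} {suc zero} _   _   = refl
Fin2-≢-≢⇒≡ {zero}     {suc zero} {zero}     a≢c _   = contradiction refl a≢c
Fin2-≢-≢⇒≡ {zero}     {suc zero} {suc zero} _   b≢c = contradiction refl b≢c
Fin2-≢-≢⇒≡ {suc zero} {zero}     {zero}     _   b≢c = contradiction refl b≢c
Fin2-≢-≢⇒≡ {suc zero} {zero}     {suc zero} a≢c _   = contradiction refl a≢c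

-- Invariance of avoidability under equality of codes.

-- Members of `IPS` are nonempty, so equality as sets of functions forces equal domains and thus
-- `i ≈ᵀ i′`; then V is carried over by reindexing. It is needed because 𝒰 is enumerated only up to
-- this equality.
avoidable-resp : ∀ {i i′ U U′ S} → U ∈ IPS [⊑ i ] → U′ ∈ IPS [⊑ i′ ] →
                 Setoid._≈_ Coded-setoid (i , U) (i′ , U′) → Avoidable i U S → Avoidable i′ U′ S
avoidable-resp {i} {i′} {U} {U′} {S} (U-resp , H , _) (U′-resp , _) (U⊆U′ , U′⊆U)
               (V , V⊆U , (V-open , ∁V-open) , (_ , V-full) , avoids) =
  V′ , (λ {x} → V′⊆U′ {x}) ,
  ((λ {x} → V′-open {x}) , (λ {x} → ∁V′-open {x})) ,
  ((λ { {x} (y , y∈V , y≈x) → y , V′⊆U′ {y} y∈V , y≈x }) , λ {x} → V′-full {x}) ,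
  avoids′
  where
  base = Homeomorphism.to H origin
  same : ⟦ [⊑ i ] ⟧ ≐ ⟦ [⊑ i′ ] ⟧
  same = let _ , _ , e , _ = U⊆U′ (proj₁ base) (proj₂ base) in e

  l : ⟦ [⊑ i ] ⟧ ⊆ ⟦ [⊑ i′ ] ⟧
  l {j} = proj₁ same {j}
  r : ⟦ [⊑ i′ ] ⟧ ⊆ ⟦ [⊑ i ] ⟧
  r {j} = proj₂ same {j}

  i≈i′ : i ≈ᵀ i′
  i≈i′ = ⊑-antisym {i} {i′} (l {i} (⊑-refl i)) (r {i′} (⊑-refl i′))

  U′⇒U : ∀ x → U′ x → U (x ↾ λ {j} → l {j})
  U′⇒U x x∈U′ = let y , y∈U , _ , e = U′⊆U x x∈U′ in U-resp (λ (j , p) → e j p (l {j} p)) y∈U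

  U⇒U′ : ∀ x → U (x ↾ λ {j} → l {j}) → U′ x
  U⇒U′ x x∈U =
    let y , y∈U′ , _ , e = U⊆U′ (x ↾ λ {j} → l {j}) x∈U in
    U′-resp (λ (j , q) k → trans (sym (e j (r {j} q) q k))
      (Func.cong x {j , l {j} (r {j} q)} {j , q} (Setoid.refl T-setoid {j}) k)) y∈U′

  V′ : Pred ∣ D^ ⟦ [⊑ i′ ] ⟧ ∣ 1ℓ
  V′ x = V (x ↾ λ {j} → l {j})

  V′⊆U′ : V′ ⊆ U′
  V′⊆U′ {x} = U⇒U′ x ∘ V⊆U

  pull : ∀ {P : Pred ∣ D^ ⟦ [⊑ i ] ⟧ ∣ 1ℓ} → Space.Open (Subspace (D^ ⟦ [⊑ i ] ⟧) U) (P ∘ proj₁) →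
         Space.Open (Subspace (D^ ⟦ [⊑ i′ ] ⟧) U′) (λ x → P (proj₁ x ↾ λ {j} → l {j}))
  pull P-open {x , x∈U′} Px =
    let bs , x◂bs , f = P-open {x ↾ (λ {j} → l {j}) , U′⇒U x x∈U′} Px in
    map (λ ((j , p) , b) → (j , l {j} p) , b) bs , All.map⁺ x◂bs ,
    λ {(y , y∈U′)} y◂bs → f {y ↾ (λ {j} → l {j}) , U′⇒U y y∈U′} (All.map⁻ y◂bs)

  V′-open : Space.Open (Subspace (D^ ⟦ [⊑ i′ ] ⟧) U′) (V′ ∘ proj₁)
  V′-open {x} = pull {V} (λ {y} → V-open {y}) {x}

  ∁V′-open : Space.Open (Subspace (D^ ⟦ [⊑ i′ ] ⟧) U′) (∁ (V′ ∘ proj₁))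
  ∁V′-open {x} = pull {∁ V} (λ {y} → ∁V-open {y}) {x}

  -- Closure of V under equality comes from its openness relative to U.
  V-resp : V Respects Space._≈_ (D^ ⟦ [⊑ i ] ⟧)
  V-resp {x} {y} x≈y x∈V =
    open-resp (Subspace (D^ ⟦ [⊑ i ] ⟧) U) (λ {z} → V-open {z})
      {x , V⊆U x∈V} {y , U-resp x≈y (V⊆U x∈V)} x≈y x∈V

  V′-full : ∀ {x} → (U′ ↾ˢ λ {j} → proj₁ {B = λ _ → ¬ (j ≈ᵀ i′)}) x →
            (V′ ↾ˢ λ {j} → proj₁ {B = λ _ → ¬ (j ≈ᵀ i′)}) x
  V′-full {x} (u , u∈U′ , u≈x) =
    let v , v∈V , v≈u = V-full {(u ↾ λ {j} → l {j}) ↾ λ {j} → proj₁ {B = λ _ → ¬ (j ≈ᵀ i)}}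
                          (u ↾ (λ {j} → l {j}) , U′⇒U u u∈U′ , λ _ _ → refl)
    in v ↾ (λ {j} → r {j}) ,
       V-resp {v} {(v ↾ λ {j} → r {j}) ↾ λ {j} → l {j}}
         (λ (j , p) → Func.cong v {j , p} {j , r {j} (l {j} p)} (Setoid.refl T-setoid {j})) v∈V ,
       λ (j , j⊑i′ , j≉i′) k →
         trans (v≈u (j , r {j} j⊑i′ , λ j≈i → j≉i′ (≈ᵀ-trans {j} {i} {i′} j≈i i≈i′)) k)
        (trans (Func.cong u {j , l {j} (r {j} j⊑i′)} {j , j⊑i′} (Setoid.refl T-setoid {j}) k)
               (u≈x (j , j⊑i′ , j≉i′) k))

  avoids′ : Empty (S ∩ (V′ ⇓ (i′ , ⊑-refl i′)))
  avoids′ s (s∈S , v , v∈V′ , v≈s) = avoids s (s∈S , v ↾ (λ {j} → l {j}) , v∈V′ ,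
    λ k → trans (cong toℕ (Func.cong v {i , l {i} (⊑-refl i)} {i′ , ⊑-refl i′} i≈i′ k)) (v≈s k))

module Classical (em : ∀ ℓ → ExcludedMiddle ℓ) where

  by-contradiction : ∀ {p} {P : Set p} → ¬ ¬ P → P
  by-contradiction = decidable-stable (em _)

  -- Cylinders and compactness of the cube.

  module Cylinders (ζ : Ξ) where
    private
      X = ∣ D^ ⟦ ζ ⟧ ∣
      I = Σ T ⟦ ζ ⟧

    open Injection (IsΞ.countable (proj₂ ζ)) public
      using () renaming (to to index; cong to index-cong; injective to index-injective)

    code : I → ℕ → ℕ
    code j k = pair (index j) k

    infix 4 _∼[_]_

    _∼[_]_ : X → ℕ → X → Set₁
    x ∼[ n ] y = ∀ j k → code j k < n → bit x j k ≡ bit y j k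

    ∼-refl : ∀ {n x} → x ∼[ n ] x
    ∼-refl _ _ _ = refl

    ∼-sym : ∀ {n x y} → x ∼[ n ] y → y ∼[ n ] x
    ∼-sym x∼y j k <n = sym (x∼y j k <n)

    ∼-trans : ∀ {n x y z} → x ∼[ n ] y → y ∼[ n ] z → x ∼[ n ] z
    ∼-trans x∼y y∼z j k <n = trans (x∼y j k <n) (y∼z j k <n)

    ∼-anti : ∀ {m n x y} → m ≤ n → x ∼[ n ] y → x ∼[ m ] y
    ∼-anti m≤n x∼y j k <m = x∼y j k (ℕ.<-≤-trans <m m≤n)

    bit-cong : ∀ x {i j k l} → code i k ≡ code j l → bit x i k ≡ bit x j l
    bit-cong x {i} {j} eq with pair-injective (index i) (index j) eq
    ... | i≡j , refl = Func.cong x (index-injective {i} {j} i≡j) _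

    ∼-suc : ∀ {n x y} j k → code j k ≡ n → x ∼[ n ] y → bit x j k ≡ bit y j k → x ∼[ suc n ] y
    ∼-suc {n} {x} {y} j k refl x∼y at i l <1+n with ℕ.m<1+n⇒m<n∨m≡n <1+n
    ... | inj₁ <n = x∼y i l <n
    ... | inj₂ ≡n = trans (bit-cong x {i} {j} ≡n) (trans at (bit-cong y {j} {i} (sym ≡n)))

    ∼-suc-vacuous : ∀ {n x y} → ¬ (∃ λ j → ∃ λ k → code j k ≡ n) → x ∼[ n ] y → x ∼[ suc n ] y
    ∼-suc-vacuous none x∼y i l <1+n with ℕ.m<1+n⇒m<n∨m≡n <1+n
    ... | inj₁ <n = x∼y i l <n
    ... | inj₂ ≡n = contradiction (i , l , ≡n) none

    -- At most one digit has code n, and it takes two values, so two centres suffice. If the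
    -- cylinder does not split, the second centre is x again.
    split : ∀ n x → ∃ λ y → y ∼[ n ] x × (∀ w → w ∼[ n ] x → w ∼[ suc n ] x ⊎ w ∼[ suc n ] y)
    split n x with em 1ℓ {∃ λ y → y ∼[ n ] x × ¬ (y ∼[ suc n ] x)}
    ... | no none =
      x , ∼-refl {x = x} , λ w w∼x → inj₁ (by-contradiction λ w≁x → none (w , w∼x , w≁x))
    ... | yes (y , y∼x , y≁x) = y , y∼x , side
      where
      side : ∀ w → w ∼[ n ] x → w ∼[ suc n ] x ⊎ w ∼[ suc n ] y
      side w w∼x with em 1ℓ {w ∼[ suc n ] x}
      ... | yes w∼x′ = inj₁ w∼x′
      ... | no  w≁x with em 1ℓ {∃ λ j → ∃ λ k → code j k ≡ n}
      ...   | no none = contradiction (∼-suc-vacuous {x = w} {x} none w∼x) w≁x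
      ...   | yes (j , k , ≡n) = inj₂ (∼-suc {x = w} {y} j k ≡n
                (∼-trans {x = w} {x} {y} w∼x (∼-sym {x = y} {x} y∼x))
                (Fin2-≢-≢⇒≡ (w≁x ∘ ∼-suc {x = w} {x} j k ≡n w∼x) (y≁x ∘ ∼-suc {x = y} {x} j k ≡n y∼x)))

    -- Compactness of the Cantor cube, by bisection.
    fan : (R : ℕ → X → Set₁) → (∀ {m n} x → m ≤ n → R m x → R n x) →
          (∀ x → ∃ λ n → ∃ λ m → ∀ y → y ∼[ n ] x → R m y) → ∃ λ m → ∀ x → R m x
    fan R mono local = let m , R-m = start in m , λ x → R-m x λ _ _ ()
      where
      Good : ℕ → X → Set₁
      Good n x = ∃ λ m → ∀ y → y ∼[ n ] x → R m y

      join : ∀ n x → (∀ y → y ∼[ n ] x → Good (suc n) y) → Good n x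
      join n x good =
        let y , y∼x , side = split n x
            m  , R-m  = good x (∼-refl {x = x})
            m′ , R-m′ = good y y∼x
        in m ℕ.⊔ m′ , λ w w∼x →
             [ mono w (ℕ.m≤m⊔n m m′) ∘ R-m w , mono w (ℕ.m≤n⊔m m m′) ∘ R-m′ w ]′ (side w w∼x)

      refine : ∀ n x → ¬ Good n x → ∃ λ y → y ∼[ n ] x × ¬ Good (suc n) y
      refine n x bad = by-contradiction λ none →
        bad (join n x λ y y∼x → by-contradiction λ bad′ → none (y , y∼x , bad′))

      -- If the whole cube is bad, bad cylinders can be chosen nested, and they shrink to a point.
      module _ (bad : ¬ Good 0 origin) where
        branch : ∀ n → ∃ λ x → ¬ Good n x
        branch zero    = origin , bad
        branch (suc n) =
          let x , bad-x = branch n ; y , _ , bad-y = refine n x bad-x in y , bad-y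

        point : ℕ → X
        point n = proj₁ (branch n)

        point-suc : ∀ n → point (suc n) ∼[ n ] point n
        point-suc n = let x , bad-x = branch n in proj₁ (proj₂ (refine n x bad-x))

        point-∼ : ∀ {m n} → suc m ℕ.≤′ n → point n ∼[ suc m ] point (suc m)
        point-∼ {m} ℕ.≤′-refl           = ∼-refl {x = point (suc m)}
        point-∼ {m} (ℕ.≤′-step {n} m<n) =
          ∼-trans {x = point (suc n)} {point n} {point (suc m)}
            (∼-anti {x = point (suc n)} {point n} (ℕ.≤′⇒≤ m<n) (point-suc n)) (point-∼ m<n)

        -- The digit with code c no longer changes from stage c + 1 on.
        digit : I → ℕ → Fin 2
        digit j k = bit (point (suc (code j k))) j k

        limit : X
        limit = record
          { to   = λ j → record { to = digit j ; cong = cong (digit j) }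
          ; cong = λ {i} {j} i≈j k →
              trans (Func.cong (point (suc (code i k))) {i} {j} i≈j k)
                    (cong (λ c → bit (point (suc (pair c k))) j k) (index-cong {i} {j} i≈j))
          }

        point-∼-limit : ∀ n → point n ∼[ n ] limit
        point-∼-limit n j k <n = point-∼ (ℕ.≤⇒≤′ <n) j k ℕ.≤-refl

      start : Good 0 origin
      start = by-contradiction λ bad →
        -- The n-cylinder of the limit is that of `point bad n`, which was chosen bad.
        let n , m , R-m = local (limit bad)
        in proj₂ (branch bad n) (m , λ y y∼ → R-m y
             (∼-trans {x = y} {point bad n} {limit bad} y∼ (point-∼-limit bad n)))

    -- Repeated splitting gives 2^n centres, a number known before any precision is chosen.
    finite-net : ∀ n → ∃ λ K → Σ (Fin K → X) λ p → ∀ x → ∃ λ r → x ∼[ n ] p r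
    finite-net zero    = 1 , (λ _ → origin) , λ _ → zero , λ _ _ ()
    finite-net (suc n) = K + K , q , q-net
      where
      K = proj₁ (finite-net n)
      p = proj₁ (proj₂ (finite-net n))
      p-net = proj₂ (proj₂ (finite-net n))
      other : Fin K → X
      other r = proj₁ (split n (p r))
      q : Fin (K + K) → X
      q = [ p , other ]′ ∘ splitAt K
      q-net : ∀ x → ∃ λ r → x ∼[ suc n ] q r
      q-net x with p-net x
      ... | r , x∼p with proj₂ (proj₂ (split n (p r))) x x∼p
      ...   | inj₁ x∼p′ = r ↑ˡ K , subst (λ s → x ∼[ suc n ] [ p , other ]′ s) (sym (Fin.splitAt-↑ˡ K r K)) x∼p′
      ...   | inj₂ x∼o  = K ↑ʳ r , subst (λ s → x ∼[ suc n ] [ p , other ]′ s) (sym (Fin.splitAt-↑ʳ K K r)) x∼o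

    near⇒∼ : ∀ {p} {P : Pred X p} {x} → Near (D^ ⟦ ζ ⟧) x P → ∃ λ n → ∀ y → y ∼[ n ] x → P y
    near⇒∼ {x = x} (bs , x◂bs , f) =
      let n , ext = bound bs x◂bs in n , λ y y∼x → f (ext y y∼x)
      where
      open Space (D^ ⟦ ζ ⟧) using (_◂_)
      bound : ∀ bs → All (x ◂_) bs → ∃ λ n → ∀ y → y ∼[ n ] x → All (y ◂_) bs
      bound [] [] = 0 , λ _ _ → []
      bound ((j , k , b) ∷ bs) (x◂b ∷ x◂bs) =
        let n , ext = bound bs x◂bs ; c = suc (code j k) in
        c ℕ.⊔ n , λ y y∼x →
          trans (y∼x j k (ℕ.m≤m⊔n c n)) x◂b ∷ ext y (∼-anti {x = y} {x} (ℕ.m≤n⊔m c n) y∼x)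

    -- At most n digits have code below n, so a cylinder is a finite intersection of subbasic sets.
    cylinder-near : ∀ n x → Near (D^ ⟦ ζ ⟧) x (_∼[ n ] x)
    cylinder-near zero    x = [] , [] , λ _ _ _ ()
    cylinder-near (suc n) x with cylinder-near n x | em 1ℓ {∃ λ j → ∃ λ k → code j k ≡ n}
    ... | bs , x◂bs , f | no none =
      bs , x◂bs , λ {y} y◂bs → ∼-suc-vacuous {x = y} {x} none (f {y} y◂bs)
    ... | bs , x◂bs , f | yes (j , k , ≡n) =
      (j , k , bit x j k) ∷ bs , refl ∷ x◂bs ,
      λ { {y} (y◂b ∷ y◂bs) → ∼-suc {x = y} {x} j k ≡n (f {y} y◂bs) y◂b }

    uniform : ∀ {A : Set} (φ : X → A) → (∀ x → Near (D^ ⟦ ζ ⟧) x (λ y → φ y ≡ φ x)) →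
              ∃ λ n → ∀ x y → y ∼[ n ] x → φ y ≡ φ x
    uniform φ φ-loc = fan (λ n x → ∀ y → y ∼[ n ] x → φ y ≡ φ x)
      (λ x m≤n const y y∼x → const y (∼-anti {x = y} {x} m≤n y∼x))
      -- Cylinders of depth n are equal or disjoint, so the n found at x serves at every point of
      -- its cylinder.
      λ x → let n , const = near⇒∼ {x = x} (φ-loc x) in
        n , n , λ y y∼x w w∼y → trans (const w (∼-trans {x = w} {y} {x} w∼y y∼x)) (sym (const y y∼x))

  -- Changing a single coordinate of a point.

  select : ∀ {p a} {P : Set p} {A : Set a} → Dec P → A → A → A
  select (yes _) a b = a
  select (no  _) a b = b

  select-yes : ∀ {p a} {P : Set p} {A : Set a} (d : Dec P) {a b : A} → P → select d a b ≡ a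
  select-yes (yes _)  _ = refl
  select-yes (no  ¬p) p = contradiction p ¬p

  select-no : ∀ {p a} {P : Set p} {A : Set a} (d : Dec P) {a b : A} → ¬ P → select d a b ≡ b
  select-no (yes p) ¬p = contradiction p ¬p
  select-no (no  _) _  = refl

  module _ (i : T) where
    private Z = ∣ D^ ⟦ [⊑ i ] ⟧ ∣

    top : Σ T ⟦ [⊑ i ] ⟧
    top = i , ⊑-refl i

    restrict : Z → ∣ D^ [⊏ i ] ∣
    restrict z = z ↾ (λ {j} → proj₁ {B = λ _ → ¬ (j ≈ᵀ i)})

    infix 4 _≈⊏_

    _≈⊏_ : Z → Z → Set₁
    x ≈⊏ y = Space._≈_ (D^ [⊏ i ]) (restrict x) (restrict y)

    update : Z → ∣ D ∣ → Z
    update z a = record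
      { to   = λ j → select (em 1ℓ {proj₁ j ≈ᵀ i}) a (z ⟨$⟩ j)
      ; cong = λ {j} {k} → update-cong {j} {k}
      }
      where
      update-cong : ∀ {j k : Σ T ⟦ [⊑ i ] ⟧} → proj₁ j ≈ᵀ proj₁ k → ∀ n →
                    select (em 1ℓ {proj₁ j ≈ᵀ i}) a (z ⟨$⟩ j) ⟨$⟩ n ≡
                    select (em 1ℓ {proj₁ k ≈ᵀ i}) a (z ⟨$⟩ k) ⟨$⟩ n
      update-cong {j} {k} j≈k n with em 1ℓ {proj₁ j ≈ᵀ i} | em 1ℓ {proj₁ k ≈ᵀ i}
      ... | yes _   | yes _   = refl
      ... | yes j≈i | no  k≉i = contradiction (≈ᵀ-trans {proj₁ k} {proj₁ j} {i} (≈ᵀ-sym {proj₁ j} {proj₁ k} j≈k) j≈i) k≉i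
      ... | no  j≉i | yes k≈i = contradiction (≈ᵀ-trans {proj₁ j} {proj₁ k} {i} j≈k k≈i) j≉i
      ... | no  _   | no  _   = Func.cong z {j} {k} j≈k n

    update-top : ∀ z a j k → proj₁ j ≈ᵀ i → bit (update z a) j k ≡ a ⟨$⟩ k
    update-top z a j k j≈i = cong (λ (d : ∣ D ∣) → d ⟨$⟩ k) (select-yes (em 1ℓ {proj₁ j ≈ᵀ i}) j≈i)

    update-⊏ : ∀ z a → update z a ≈⊏ z
    update-⊏ z a (j , j⊏i) k = cong (λ (d : ∣ D ∣) → d ⟨$⟩ k) (select-no (em 1ℓ {j ≈ᵀ i}) (proj₂ j⊏i))

    -- Uniform continuity of the parametrization of U and of its inverse.

    module _ (U : Pred Z 1ℓ) (U∈IPS : U ∈ IPS [⊑ i ]) where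
      open Cylinders [⊑ i ]

      private
        U-space = Subspace (D^ ⟦ [⊑ i ] ⟧) U
        U-resp = proj₁ U∈IPS
        module H = Homeomorphism (proj₁ (proj₂ U∈IPS))

        keep = proj₂ (proj₂ U∈IPS)

        h : Z → Z
        h = proj₁ ∘ H.to

        h-sub : SubbasicallyContinuous (D^ ⟦ [⊑ i ] ⟧) (D^ ⟦ [⊑ i ] ⟧) h
        h-sub = continuous⇒subbasically (D^ ⟦ [⊑ i ] ⟧) U-space H.to-continuous

        keep-⊏ : ∀ x y → x ≈⊏ y → h x ≈⊏ h y
        keep-⊏ x y = Equivalence.to (keep x y [⊏ i ]ᶻ (λ {j} → proj₁ {B = λ _ → ¬ (j ≈ᵀ i)}))

      bits-code : ∀ J → ∃ λ N → ∀ k → k < J → code top k < N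
      bits-code = bounded-choice (λ k N → code top k < N) (λ _ m≤n <m → ℕ.<-≤-trans <m m≤n)
                                 (λ k → suc (code top k) , ℕ.≤-refl)

      ∼-from-parts : ∀ {n x y} →
        (∀ j (j⊏i : j ⊏ i) k → code (j , proj₁ j⊏i) k < n → bit x (j , proj₁ j⊏i) k ≡ bit y (j , proj₁ j⊏i) k) →
        (∀ k → k < n → bit x top k ≡ bit y top k) → x ∼[ n ] y
      ∼-from-parts {n} {x} {y} below at (j , j⊑i) k <n with em 1ℓ {j ≈ᵀ i}
      ... | no  j≉i = below j (j⊑i , j≉i) k <n
      -- A place k is at most the code of its digit, so a code below n gives k below n.
      ... | yes j≈i = trans (Func.cong x {j , j⊑i} {top} j≈i k)
                     (trans (at k (ℕ.≤-<-trans (n≤pair (index (j , j⊑i)) k) <n))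
                            (Func.cong y {top} {j , j⊑i} (≈ᵀ-sym {j} {i} j≈i) k))

      -- Uniform continuity of the inverse, phrased through h so that compactness of the parameter
      -- cube applies instead of compactness of U.
      inverse-uniform : ∀ J → ∃ λ M → ∀ k → k < J →
                        ∀ z z′ → h z′ ∼[ M ] h z → bit z′ top k ≡ bit z top k
      inverse-uniform = bounded-choice
        (λ k M → ∀ z z′ → h z′ ∼[ M ] h z → bit z′ top k ≡ bit z top k)
        (λ k m≤n sep z z′ h∼ → sep z z′ (∼-anti {x = h z′} {h z} m≤n h∼))
        λ k → fan (λ M z → ∀ z′ → h z′ ∼[ M ] h z → bit z′ top k ≡ bit z top k)
          (λ z m≤n sep z′ h∼ → sep z′ (∼-anti {x = h z′} {h z} m≤n h∼))
          (local k)
        where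
        local : ∀ k z → ∃ λ n → ∃ λ M → ∀ y → y ∼[ n ] z →
                ∀ z′ → h z′ ∼[ M ] h y → bit z′ top k ≡ bit y top k
        local k z =
          let bs , hz◂bs , f = continuous⇒subbasically U-space (D^ ⟦ [⊑ i ] ⟧) H.from-continuous
                                 {H.to z} (top , k , bit z top k) (H.strictlyInverseʳ z top k)
              M , near-hz = near⇒∼ {x = h z} (bs , hz◂bs , id)
              -- Within depth n of z the map h stays M-close to `h z`, so the same M serves at every
              -- such y.
              n , near-z  = near⇒∼ {x = z} (near-preimage (D^ ⟦ [⊑ i ] ⟧) (D^ ⟦ [⊑ i ] ⟧) {h} h-sub {_∼[ M ] h z} {z}
                              (cylinder-near M (h z)))
              same : ∀ w → h w ∼[ M ] h z → bit w top k ≡ bit z top k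
              same w hw∼hz = trans (sym (H.strictlyInverseʳ w top k)) (f {H.to w} (near-hz (h w) hw∼hz))
          in n , M , λ y y∼z z′ hz′∼hy →
               trans (same z′ (∼-trans {x = h z′} {h y} {h z} hz′∼hy (near-z y y∼z)))
                     (sym (same y (near-z y y∼z)))

      forward-uniform : ∀ M → ∃ λ N → ∀ k → k < M →
                        ∀ z z′ → z′ ∼[ N ] z → bit (h z′) top k ≡ bit (h z) top k
      forward-uniform = bounded-choice
        (λ k N → ∀ z z′ → z′ ∼[ N ] z → bit (h z′) top k ≡ bit (h z) top k)
        (λ k m≤n const z z′ z∼ → const z z′ (∼-anti {x = z′} {z} m≤n z∼))
        λ k → uniform (λ z → bit (h z) top k) λ z → h-sub {z} (top , k , bit (h z) top k) refl

      -- Markers with a single 1 pick K + 1 of the 2^(K + 1) pieces cut out by the first K + 1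
      -- digits.
      marker : ∀ {K} → Fin K → ∣ D ∣
      marker r = record { to = λ k → select (toℕ r ℕ.≟ k) (suc zero) zero ; cong = λ { refl → refl } }

      marker-injective : ∀ {K} (r s : Fin K) → marker r ⟨$⟩ toℕ r ≡ marker s ⟨$⟩ toℕ r → r ≡ s
      marker-injective r s eq with toℕ r ℕ.≟ toℕ r | toℕ s ℕ.≟ toℕ r
      ... | no r≢r | _       = contradiction refl r≢r
      ... | yes _  | yes s≡r = sym (Fin.toℕ-injective s≡r)
      marker-injective r s () | yes _ | no _

      -- Avoiding K balls of radius M.

      module _ (K M N : ℕ)
        (separated : ∀ k → k < suc K → ∀ z z′ → h z′ ∼[ M ] h z → bit z′ top k ≡ bit z top k)
        (N-bits : ∀ k → k < M → ∀ z z′ → z′ ∼[ N ] z → bit (h z′) top k ≡ bit (h z) top k)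
        (N-top : ∀ k → k < suc K → code top k < N)
        (p : Fin K → ∣ 𝒩 ∣) (S : Pred ∣ 𝒩 ∣ 1ℓ)
        (covered : ∀ s → s ∈ S → ∃ λ r → ∀ k → k < M → s ⟨$⟩ k ≡ p r ⟨$⟩ k) where

        Hits : Z → Fin K → Set
        Hits z r = ∀ k → k < M → toℕ (bit (h z) top k) ≡ p r ⟨$⟩ k

        SamePiece : Z → Z → Set₁
        SamePiece z′ z = z′ ≈⊏ z × (∀ k → k < suc K → bit z′ top k ≡ bit z top k)

        -- The parameters whose whole piece, over their own coordinates below i, misses every ball.
        W : Pred Z 1ℓ
        W z = ∀ z′ → SamePiece z′ z → ∀ r → ¬ Hits z′ r

        -- A hit over y moves to x by keeping its i-th coordinate and taking the lower ones from x.
        -- N is large enough to preserve both the piece and the first M digits of the image at i.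
        W-∼ : ∀ {x y} → x ∼[ N ] y → W x → W y
        W-∼ {x} {y} x∼y Wx z (z≈y , z-top) r hits = Wx z′ (update-⊏ x a , top-x) r hits′
          where
          a = z ⟨$⟩ top
          z′ = update x a
          z∼z′ : z ∼[ N ] z′
          z∼z′ = ∼-from-parts {x = z} {z′}
            (λ j j⊏i k <N → trans (z≈y (j , j⊏i) k)
              (trans (sym (x∼y (j , proj₁ j⊏i) k <N)) (sym (update-⊏ x a (j , j⊏i) k))))
            λ k _ → sym (update-top x a top k (Setoid.refl T-setoid {i}))
          top-x : ∀ k → k < suc K → bit z′ top k ≡ bit x top k
          top-x k k<1+K = trans (update-top x a top k (Setoid.refl T-setoid {i}))
                       (trans (z-top k k<1+K)
                              (sym (x∼y top k (N-top k k<1+K))))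
          hits′ : Hits z′ r
          hits′ k k<M = trans (cong toℕ (sym (N-bits k k<M z′ z z∼z′))) (hits k k<M)

        -- Equal coordinates below i stay equal under h, and a common ball makes the images agree on
        -- M digits at i. So the images are M-close, and `separated` recovers the same marker digit
        -- at place s.
        pieces-apart : ∀ z {x y r} s s′ →
                       SamePiece x (update z (marker s)) → SamePiece y (update z (marker s′)) →
                       Hits x r → Hits y r → s ≡ s′
        pieces-apart z {x} {y} s s′ (x≈ , x-top) (y≈ , y-top) x-hits y-hits =
          marker-injective s s′ (trans (sym (at x s x-top))
            (trans (sym (separated (toℕ s) (Fin.toℕ<n s) x y hy∼hx)) (at y s′ y-top)))
          where
          at : ∀ w t → (∀ k → k < suc K → bit w top k ≡ bit (update z (marker t)) top k) →
               bit w top (toℕ s) ≡ marker t ⟨$⟩ toℕ s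
          at w t w-top = trans (w-top (toℕ s) (Fin.toℕ<n s))
                               (update-top z (marker t) top (toℕ s) (Setoid.refl T-setoid {i}))
          y≈x : y ≈⊏ x
          y≈x j k = trans (y≈ j k) (trans (update-⊏ z (marker s′) j k)
                   (trans (sym (update-⊏ z (marker s) j k)) (sym (x≈ j k))))
          hy∼hx : h y ∼[ M ] h x
          hy∼hx = ∼-from-parts {x = h y} {h x} (λ j j⊏i k _ → keep-⊏ y x y≈x (j , j⊏i) k)
            λ k k<M → Fin.toℕ-injective (trans (y-hits k k<M) (sym (x-hits k k<M)))

        -- K + 1 pieces, K balls, and no ball meets two of the pieces.
        W-nonempty : ∀ z → ∃ λ z′ → z′ ≈⊏ z × W z′
        W-nonempty z = by-contradiction λ none →
          let
            hit : ∀ (s : Fin (suc K)) → ∃ λ r → ∃ λ z′ → SamePiece z′ (update z (marker s)) × Hits z′ r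
            hit s = by-contradiction λ no-hit →
              none (update z (marker s) , update-⊏ z (marker s) ,
                    λ z′ same r hits → no-hit (r , z′ , same , hits))
            s , s′ , s<s′ , same = Fin.pigeonhole ℕ.≤-refl (proj₁ ∘ hit)
            r  , x , x-same , x-hits = hit s
            r′ , y , y-same , y-hits = hit s′
          in Fin.<⇒≢ s<s′ (pieces-apart z s s′ x-same y-same x-hits (subst (Hits y) (sym same) y-hits))

        V : Pred Z 1ℓ
        V u = ∃ λ z → Space._≈_ (D^ ⟦ [⊑ i ] ⟧) (h z) u × W z

        V⇒W : ∀ u → V (proj₁ u) → W (H.from u)
        V⇒W u (z , hz≈u , Wz) =
          W-∼ {z} {H.from u} (λ j k _ → sym (H.inverseʳ {z} {u} (λ j k → sym (hz≈u j k)) j k)) Wz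

        W⇒V : ∀ u → W (H.from u) → V (proj₁ u)
        W⇒V u W-u = H.from u , H.strictlyInverseˡ u , W-u

        ∼-invariant-open : ∀ (O : Pred Z 1ℓ) → (∀ x y → x ∼[ N ] y → O x → O y) →
                           Space.Open (D^ ⟦ [⊑ i ] ⟧) O
        ∼-invariant-open O inv {z} z∈O =
          let bs , z◂bs , f = cylinder-near N z in
          bs , z◂bs , λ {y} y◂bs → inv z y (∼-sym {x = y} {z} (f {y} y◂bs)) z∈O

        V-clopen : Space.Clopen U-space (V ∘ proj₁)
        V-clopen = (λ {u} → V-open {u}) , (λ {u} → ∁V-open {u})
          where
          V-open : Space.Open U-space (V ∘ proj₁)
          V-open {u} u∈V =
            let bs , u◂bs , f = H.from-continuous W (λ {z} → ∼-invariant-open W (λ x y → W-∼ {x} {y}) {z}) {u} (V⇒W u u∈V)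
            in bs , u◂bs , λ {v} v◂bs → W⇒V v (f {v} v◂bs)
          ∁W-∼ : ∀ x y → x ∼[ N ] y → ∁ W x → ∁ W y
          ∁W-∼ x y x∼y ¬Wx Wy = ¬Wx (W-∼ {y} {x} (∼-sym {x = x} {y} x∼y) Wy)
          ∁V-open : Space.Open U-space (∁ (V ∘ proj₁))
          ∁V-open {u} u∉V =
            let bs , u◂bs , f = H.from-continuous (∁ W) (λ {z} → ∼-invariant-open (∁ W) ∁W-∼ {z}) {u} (u∉V ∘ W⇒V u)
            in bs , u◂bs , λ {v} v◂bs → f {v} v◂bs ∘ V⇒W v

        avoid : Avoidable i U S
        avoid = V ,
          (λ { {u} (z , hz≈u , _) → U-resp {h z} {u} hz≈u (proj₂ (H.to z)) }) ,
          ((λ {u} → proj₁ V-clopen {u}) , (λ {u} → proj₂ V-clopen {u})) ,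
          ((λ { {x} (v , (z , hz≈v , _) , v≈x) → v , U-resp {h z} {v} hz≈v (proj₂ (H.to z)) , v≈x }) ,
           -- Moving the parameter of u into W leaves its coordinates below i alone, and projection
           -- keeping passes this on to the image.
           (λ { {x} (u , u∈U , u≈x) →
             let z = H.from (u , u∈U)
                 z′ , z′≈z , Wz′ = W-nonempty z
             in h z′ , (z′ , (λ _ _ → refl) , Wz′) ,
                λ j k → trans (keep-⊏ z′ z z′≈z j k)
                       (trans (H.strictlyInverseˡ (u , u∈U) (proj₁ j , proj₁ (proj₂ j)) k) (u≈x j k)) })) ,
          -- A common point lies in some ball r, so z itself hits r, against `Wz`.
          λ { s (s∈S , v , (z , hz≈v , Wz) , v≈s) →
            let r , close = covered s s∈S in
            Wz z ((λ _ _ → refl) , λ _ _ → refl) r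
              λ k k<M → trans (cong toℕ (hz≈v top k)) (trans (v≈s k) (close k k<M)) }

      -- M comes before the centres and before S. Hence all precisions can be fixed before Y is
      -- constructed.
      avoidable-near : ∀ K → ∃ λ M → (p : Fin K → ∣ 𝒩 ∣) (S : Pred ∣ 𝒩 ∣ 1ℓ) →
        (∀ s → s ∈ S → ∃ λ r → ∀ k → k < M → s ⟨$⟩ k ≡ p r ⟨$⟩ k) → Avoidable i U S
      avoidable-near K =
        let M , separated = inverse-uniform (suc K)
            m , m-bits    = forward-uniform M
            n , n-top     = bits-code (suc K)
        in M , avoid K M (m ℕ.⊔ n) separated
             (λ k k<M z z′ z∼ → m-bits k k<M z z′ (∼-anti {x = z′} {z} (ℕ.m≤m⊔n m n) z∼))
             (λ k k<1+K → ℕ.<-≤-trans (n-top k k<1+K) (ℕ.m≤n⊔m m n))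

  -- Products of perfect sets with sparse free digits, and their images.

  module Spread (ζ : Ξ) {f : ℕ → ℕ} (increasing : StrictlyIncreasingAbove f) where
    open Cylinders ζ
    open StrictlyIncreasingAbove increasing

    private X = ∣ D^ ⟦ ζ ⟧ ∣

    read : ∀ c k → Dec (∃ λ l → t (pair c l) ≡ k) → (ℕ → Fin 2) → Fin 2
    read c k (yes (l , _)) a = a l
    read c k (no _)        a = zero

    column : ℕ → (ℕ → Fin 2) → ℕ → Fin 2
    column c a k = read c k (em 0ℓ) a

    column-cong : ∀ c k {a b} → (∀ l → a l ≡ b l) → column c a k ≡ column c b k
    column-cong c k a≈b with em 0ℓ {∃ λ l → t (pair c l) ≡ k}
    ... | yes (l , _) = a≈b l
    ... | no _        = refl

    column-pos : ∀ c a l → column c a (t (pair c l)) ≡ a l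
    column-pos c a l with em 0ℓ {∃ λ l′ → t (pair c l′) ≡ t (pair c l)}
    ... | yes (l′ , eq) = cong a (proj₂ (pair-injective c c (t-injective eq)))
    ... | no none       = contradiction (l , refl) none

    column-dichotomy : ∀ c k → (∃ λ l → t (pair c l) ≡ k × (∀ a → column c a k ≡ a l)) ⊎
                               (∀ a → column c a k ≡ zero)
    column-dichotomy c k with em 0ℓ {∃ λ l → t (pair c l) ≡ k}
    ... | yes (l , eq) = inj₁ (l , eq , λ _ → refl)
    ... | no _         = inj₂ λ _ → refl

    -- The digit with code n moves to place `t n` of its own coordinate, and all other places hold
    -- 0. Staying inside the coordinate is what keeps projections.
    spread : X → X
    spread x = record
      { to   = λ j → record { to = column (index j) (bit x j) ; cong = cong (column (index j) (bit x j)) }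
      ; cong = λ {i} {j} i≈j k →
          trans (cong (λ c → column c (bit x i) k) (index-cong {i} {j} i≈j))
                (column-cong (index j) k (Func.cong x {i} {j} i≈j))
      }

    gather : X → X
    gather y = record
      { to   = λ j → record { to = λ l → bit y j (t (code j l)) ; cong = cong (λ l → bit y j (t (code j l))) }
      ; cong = λ {i} {j} i≈j l →
          trans (Func.cong y {i} {j} i≈j (t (code i l)))
                (cong (λ c → bit y j (t (pair c l))) (index-cong {i} {j} i≈j))
      }

    gather-spread : ∀ x → Space._≈_ (D^ ⟦ ζ ⟧) (gather (spread x)) x
    gather-spread x j l = column-pos (index j) (bit x j) l

    spread-subbasically : SubbasicallyContinuous (D^ ⟦ ζ ⟧) (D^ ⟦ ζ ⟧) spread
    spread-subbasically {x} (j , k , b) ◂b with column-dichotomy (index j) k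
    ... | inj₁ (l , _ , eq) = (j , l , b) ∷ [] , trans (sym (eq (bit x j))) ◂b ∷ [] ,
                              λ { {y} (y◂ ∷ []) → trans (eq (bit y j)) y◂ }
    ... | inj₂ eq = [] , [] , λ {y} _ → trans (eq (bit y j)) (trans (sym (eq (bit x j))) ◂b)

    gather-subbasically : SubbasicallyContinuous (D^ ⟦ ζ ⟧) (D^ ⟦ ζ ⟧) gather
    gather-subbasically (j , l , b) ◂b = (j , t (code j l) , b) ∷ [] , ◂b ∷ [] , λ { (y◂ ∷ []) → y◂ }

    -- A free digit at place `t c` has code at least `t c`. If that code is below m, then
    -- `t c < t n`, so c is below n and the digit is already shared.
    spread-∼ : ∀ {m n x y} → m ≤ t n → x ∼[ n ] y → spread x ∼[ m ] spread y
    spread-∼ {m} {n} {x} {y} m≤tn x∼y j k <m with column-dichotomy (index j) k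
    ... | inj₂ eq = trans (eq (bit x j)) (sym (eq (bit y j)))
    ... | inj₁ (l , refl , eq) =
      trans (eq (bit x j)) (trans (x∼y j l (t-cancel-<
        (ℕ.<-≤-trans (ℕ.≤-<-trans (n≤pair (index j) (t (code j l))) <m) m≤tn))) (sym (eq (bit y j))))

    spread-keeps : ∀ x y {η} (η⊆ζ : η ⊆ ⟦ ζ ⟧) → Space._≈_ (D^ η) (x ↾ λ {j} → η⊆ζ {j}) (y ↾ λ {j} → η⊆ζ {j}) →
                   Space._≈_ (D^ η) (spread x ↾ λ {j} → η⊆ζ {j}) (spread y ↾ λ {j} → η⊆ζ {j})
    spread-keeps x y η⊆ζ x≈y (j , p) k = column-cong (index (j , η⊆ζ {j} p)) k (x≈y (j , p))

    spread-reflects : ∀ x y {η} (η⊆ζ : η ⊆ ⟦ ζ ⟧) →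
                      Space._≈_ (D^ η) (spread x ↾ λ {j} → η⊆ζ {j}) (spread y ↾ λ {j} → η⊆ζ {j}) →
                      Space._≈_ (D^ η) (x ↾ λ {j} → η⊆ζ {j}) (y ↾ λ {j} → η⊆ζ {j})
    spread-reflects x y η⊆ζ eq (j , p) l =
      trans (sym (gather-spread x (j , η⊆ζ {j} p) l))
     (trans (eq (j , p) (t (code (j , η⊆ζ {j} p) l))) (gather-spread y (j , η⊆ζ {j} p) l))

    module _ (P : Pred X 1ℓ) (P∈IPS : P ∈ IPS ζ) where
      private
        A       = D^ ⟦ ζ ⟧
        P-space = Subspace A P
        P-resp  = proj₁ P∈IPS
        keep    = proj₂ (proj₂ P∈IPS)
        module H = Homeomorphism (proj₁ (proj₂ P∈IPS))
        open Space A using (_≈_)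

      embed : X → X
      embed = proj₁ ∘ H.to ∘ spread

      Range : Pred X 1ℓ
      Range w = ∃ λ x → embed x ≈ w

      Range⊆P : Range ⊆ P
      Range⊆P (x , e) = P-resp e (proj₂ (H.to (spread x)))

      private
        R-space = Subspace A Range

        include : ∣ R-space ∣ → ∣ P-space ∣
        include (w , w∈R) = w , Range⊆P w∈R

        from : ∣ R-space ∣ → X
        from = gather ∘ H.from ∘ include

        gather-cong : ∀ {x y} → x ≈ y → gather x ≈ gather y
        gather-cong x≈y j l = x≈y j (t (code j l))

        from-embed : ∀ {w} x → embed x ≈ proj₁ w → from w ≈ x
        from-embed {w} x e j l =
          trans (gather-cong {H.from (include w)} {spread x}
                  (H.inverseʳ {spread x} {include w} λ j k → sym (e j k)) j l)
                (gather-spread x j l)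

        embed-cong : ∀ {x y} → x ≈ y → embed x ≈ embed y
        embed-cong {x} {y} x≈y = H.to-cong {spread x} {spread y} (spread-keeps x y id x≈y)

        H-cont : Continuous A A (proj₁ ∘ H.to)
        H-cont = continuous-proj₁ A A H.to-continuous

        spread-cont : Continuous A A spread
        spread-cont = subbasically⇒continuous A A {spread} λ {x} → spread-subbasically {x}

        gather-cont : Continuous A A gather
        gather-cont = subbasically⇒continuous A A {gather} λ {x} → gather-subbasically {x}

        include-cont : Continuous R-space P-space include
        include-cont = subbasically⇒continuous R-space P-space {include}
          λ { {x} b ◂b → b ∷ [] , ◂b ∷ [] , λ { (y◂ ∷ []) → y◂ } }

        from-cont : Continuous R-space A from
        from-cont = continuous-∘ R-space P-space A {include} {gather ∘ H.from}
          (continuous-∘ P-space A A {H.from} {gather} gather-cont H.from-continuous) include-cont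

      embed-continuous : Continuous A A embed
      embed-continuous = continuous-∘ A A A {spread} {proj₁ ∘ H.to} H-cont spread-cont

      -- `gather` after the inverse for P inverts `embed`. Both `spread` and the homeomorphism onto
      -- P keep and reflect equality of projections, hence so does their composition.
      Range∈IPS : Range ∈ IPS ζ
      Range∈IPS = (λ v≈w (x , e) → x , λ j k → trans (e j k) (v≈w j k)) ,
        record
          { inverse = record
            { to        = λ x → embed x , x , λ _ _ → refl
            ; from      = from
            ; to-cong   = λ {x} {y} → embed-cong {x} {y}
            ; from-cong = λ {v} {w} v≈w →
                gather-cong {H.from (include v)} {H.from (include w)} (H.from-cong {include v} {include w} v≈w)
            ; inverse   =
                (λ { {w , x , e} {y} y≈from j k → trans (embed-cong {y} {x}
                       (λ j k → trans (y≈from j k) (from-embed {w , x , e} x e j k)) j k) (e j k) }) ,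
                (λ { {x} {w} w≈ → from-embed {w} x λ j k → sym (w≈ j k) })
            }
          ; to-continuous   = subbasically⇒continuous A R-space
              λ {x} → continuous⇒subbasically A A {embed} embed-continuous {x}
          ; from-continuous = from-cont
          } ,
        λ x y η η⊆ζ → let module K = Equivalence (keep (spread x) (spread y) η (λ {j} → η⊆ζ {j})) in
          mk⇔ (K.to ∘ spread-keeps x y (λ {j} → η⊆ζ {j})) (spread-reflects x y (λ {j} → η⊆ζ {j}) ∘ K.from)

  -- Choice of the free places and of Y.

  module Construction (ξ : Ξ) (X : Pred ∣ D^ ⟦ ξ ⟧ ∣ 1ℓ) (X∈IPS : X ∈ IPS ξ)
                      (F : ∣ D^ ⟦ ξ ⟧ ∣ → ∣ 𝒩 ∣) (F-cont : Continuous (D^ ⟦ ξ ⟧) 𝒩 F)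
                      (𝒰 : Pred Coded 1ℓ) (𝒰-IPS : ∀ i U → (i , U) ∈ 𝒰 → U ∈ IPS [⊑ i ])
                      (count : Countable (SubSetoid Coded-setoid 𝒰)) where
    open Cylinders ξ
    private
      A = D^ ⟦ ξ ⟧
      module H = Homeomorphism (proj₁ (proj₂ X∈IPS))

    Φ : ∣ A ∣ → ∣ 𝒩 ∣
    Φ x = F (proj₁ (H.to x))

    Φ-uniform : ∀ m → ∃ λ n → ∀ k → k < m → ∀ x y → y ∼[ n ] x → Φ y ⟨$⟩ k ≡ Φ x ⟨$⟩ k
    Φ-uniform = bounded-choice (λ k n → ∀ x y → y ∼[ n ] x → Φ y ⟨$⟩ k ≡ Φ x ⟨$⟩ k)
      (λ k m≤n const x y y∼x → const x y (∼-anti {x = y} {x} m≤n y∼x))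
      λ k → uniform (λ x → Φ x ⟨$⟩ k) (continuous⇒locallyConstant A Φ-cont k)
      where
      Φ-cont : Continuous A 𝒩 Φ
      Φ-cont = continuous-∘ A A 𝒩 {proj₁ ∘ H.to} {F} F-cont (continuous-proj₁ A A H.to-continuous)

    Listed : ℕ → Set₂
    Listed n = ∃ λ (c : Σ Coded 𝒰) → Injection.to count c ≡ n

    net-size : ℕ → ℕ
    net-size n = proj₁ (finite-net n)

    -- An index that lists no member imposes no condition, hence 0. The decision is an argument so
    -- that `from-precision` can split on it.
    precision : ∀ {n} → Dec (Listed n) → ℕ
    precision {n} (yes (((i , U) , U∈𝒰) , _)) = proj₁ (avoidable-near i U (𝒰-IPS i U U∈𝒰) (net-size n))
    precision     (no _)                      = 0

    -- Net size, precision and modulus at n are fixed in this order, all before the places `t`, so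
    -- nothing is circular.
    modulus : ℕ → ℕ
    modulus n = proj₁ (Φ-uniform (precision {n} (em _)))

    increasing = strictlyIncreasingAbove modulus
    open Spread ξ increasing
    open StrictlyIncreasingAbove increasing

    Y : Pred ∣ A ∣ 1ℓ
    Y = Range X X∈IPS

    center : ∀ n → Fin (net-size n) → ∣ 𝒩 ∣
    center n r = Φ (spread (proj₁ (proj₂ (finite-net n)) r))

    Covered : ℕ → ℕ → Set₁
    Covered n m = ∀ s → s ∈ F [ Y ] → ∃ λ r → ∀ k → k < m → s ⟨$⟩ k ≡ center n r ⟨$⟩ k

    -- A net point sharing the first n digits of x agrees with it after spreading up to depth `t n`,
    -- which is at least the modulus of Φ for the n-th precision.
    image-covered : ∀ n → Covered n (precision {n} (em _))
    image-covered n s (w , (x , hx≈w) , Fw≈s) =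
      let q , net = proj₂ (finite-net n)
          r , x∼q = net x
          m≤t = f≤t n
      in r , λ k k<m →
        trans (sym (Fw≈s k)) (trans (continuous⇒cong A F-cont {proj₁ (H.to (spread x))} {w} hx≈w k)
          (proj₂ (Φ-uniform (precision {n} (em _))) k k<m (spread (q r)) (spread x)
            (spread-∼ {x = x} {q r} m≤t x∼q)))

    avoidable : ∀ i U → (i , U) ∈ 𝒰 → Avoidable i U (F [ Y ])
    avoidable i U U∈𝒰 = from-precision (em _) (image-covered n)
      where
      n = Injection.to count ((i , U) , U∈𝒰)
      from-precision : (d : Dec (Listed n)) → Covered n (precision d) → Avoidable i U (F [ Y ])
      from-precision (no none) _ = contradiction (((i , U) , U∈𝒰) , refl) none
      -- The member found at index n is only equal as a code to the given one, so avoidability is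
      -- transported.
      from-precision (yes (((i′ , U′) , U′∈𝒰) , eq)) covered =
        avoidable-resp (𝒰-IPS i′ U′ U′∈𝒰) (𝒰-IPS i U U∈𝒰)
          (Injection.injective count {(i′ , U′) , U′∈𝒰} {(i , U) , U∈𝒰} eq)
          (proj₂ (avoidable-near i′ U′ (𝒰-IPS i′ U′ U′∈𝒰) (net-size n)) (center n) (F [ Y ]) covered)

theorem3p18 : (∀ ℓ → ExcludedMiddle ℓ) →
    V=L →
    (ξ : Ξ) (X : Pred ∣ D^ ⟦ ξ ⟧ ∣ 1ℓ) → X ∈ IPS ξ →
    (F : ∣ D^ ⟦ ξ ⟧ ∣ → ∣ 𝒩 ∣) → Continuous (D^ ⟦ ξ ⟧) 𝒩 F →
    (𝒰 : Pred Coded 1ℓ) →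
    (∀ i U → (i , U) ∈ 𝒰 → U ∈ IPS [⊑ i ]) →
    Countable (SubSetoid Coded-setoid 𝒰) →
    Σ (Pred ∣ D^ ⟦ ξ ⟧ ∣ 1ℓ) λ Y →
    Y ∈ IPS ξ × Y ⊆ X ×
    (∀ i U → U ∈ IPS [⊑ i ] → (i , U) ∈ 𝒰 → Avoidable i U (F [ Y ]))
theorem3p18 em _ ξ X X∈IPS F F-cont 𝒰 𝒰-IPS count =
  Y , Range∈IPS X X∈IPS , (λ {x} → Range⊆P X X∈IPS {x}) , λ i U _ → avoidable i U
  where
  open Classical em
  open Construction ξ X X∈IPS F F-cont 𝒰 𝒰-IPS count
  open Spread ξ increasing
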